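{- For every $\mathsf{u}\in\mathcal{A}$, the rightmost equitable partition of $\mathsf{u}$ equals the successful partition of $\mathsf{u}$; in particular the rightmost equitable partition of $\mathsf{u}$ is successful.
   Context: Fix positive integers $m,N$. Let $\mathcal{A}$ be the set of words $\mathsf{u}=\mathsf{u}_1\cdots\mathsf{u}_N$ of length $N$ over $\{0,1,\ldots,m-1\}$; write $|\mathsf{u}|=\sum_i\mathsf{u}_i$ and $|\mathsf{u}|_m=|\mathsf{u}|\bmod m$. A partitioned word of $\mathsf{u}$ is a decomposition $\mathsf{u}^*=\mathsf{u}^*_{m-1}|\cdots|\mathsf{u}^*_0$ of $\mathsf{u}$ into $m$ possibly empty consecutive factors (blocks) whose concatenation is $\mathsf{u}$; $\mathsf{block}(\mathsf{u}^*,i)=k$ if $\mathsf{u}_i$ lies in $\mathsf{u}^*_k$. The balancing array of $\mathsf{u}^*$ is the $N\times m$ array (rows $i=1..N$, columns $j=m-1,\ldots,0$) whose entry $(i,j)$ is filled iff $j\equiv\mathsf{block}(\mathsf{u}^*,i)-t\pmod m$ for some $0\le t\le\mathsf{u}_i-1$. Column $j$ is equitably filled if it has exactly $\lfloor|\mathsf{u}|/m\rfloor+1$ filled entries when $1\le j\le|\mathsf{u}|_m$ and exactly $\lfloor|\mathsf{u}|/m\rfloor$ when $j=0$ or $j>|\mathsf{u}|_m$; $\mathsf{u}^*$ is an equitable partition if all columns are equitably filled. The rightmost equitable partition of $\mathsf{u}$ is the (unique) equitable partition $\mathsf{u}^*$ such that every equitable partition $\mathsf{v}^*$ of $\mathsf{u}$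 has $\mathsf{block}(\mathsf{v}^*,i)\ge\mathsf{block}(\mathsf{u}^*,i)$ for all $i$. Successful partitions: on a partitioned word $\mathsf{u}^*$, set $L:=|\mathsf{u}|_m$ and repeat $N$ times: if block $\mathsf{u}^*_L$ (of not-yet-removed letters) is empty, stop and fail; otherwise remove its leftmost remaining letter $x$ and set $L:=(L-x)\bmod m$. If all $N$ steps complete, $\mathsf{u}^*$ is a successful partition of $\mathsf{u}$. It is known that every $\mathsf{u}\in\mathcal{A}$ has exactly one successful partition, called the successful partition of $\mathsf{u}$. -}

module Defs where

open import Data.Nat using (ℕ; zero; suc; _+_; _∸_; _≤_; _<_; NonZero)
import Data.Nat as ℕ
open import Data.Nat.DivMod using (_%_; _/_)
open import Data.Nat.ListAction using (sum)
open import Data.Fin using (Fin; toℕ)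
import Data.Fin as F
import Data.Fin.Properties as FP
open import Data.List using (List; []; _∷_; map; filter; length; allFin)
open import Data.Product using (Σ; ∃; _×_; _,_)
open import Data.Sum using (_⊎_)
open import Data.Bool using (Bool; true; false)
open import Relation.Nullary using (Dec; ¬_)
open import Relation.Nullary.Decidable using (¬?)
open import Relation.Binary.PropositionalEquality using (_≡_)

-- A word u = u_1 ⋯ u_N over {0,…,m-1}; positions are Fin N (position i ↦ letter i+1).
Word : ℕ → ℕ → Set
Word m N = Fin N → Fin m

∣_∣w : ∀ {m N} → Word m N → ℕ
∣_∣w {N = N} u = sum (map (λ i → toℕ (u i)) (allFin N))

-- A partitioned word u* = u*_{m-1} | ⋯ | u*_0 is determined by its block function
-- i ↦ block(u*, i); consecutive (possibly empty) blocks in the order m-1,…,0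
-- from left to right means exactly that the block function is weakly decreasing.
BlockFn : ℕ → ℕ → Set
BlockFn m N = Fin N → Fin m

IsPartition : ∀ {m N} → BlockFn m N → Set
IsPartition {N = N} b = (i j : Fin N) → i F.≤ j → b j F.≤ b i

-- Balancing array: entry (i , j) is filled iff j ≡ block(u*,i) - t (mod m)
-- for some 0 ≤ t ≤ u_i - 1, i.e. j + t ≡ block(u*,i) (mod m).
Filled : ∀ m .{{_ : NonZero m}} {N} → Word m N → BlockFn m N → Fin N → Fin m → Set
Filled m u b i j = Σ (Fin (toℕ (u i))) λ t → (toℕ j + toℕ t) % m ≡ toℕ (b i) % m

filled? : ∀ m .{{_ : NonZero m}} {N} (u : Word m N) (b : BlockFn m N) (j : Fin m) (i : Fin N) →
          Dec (Filled m u b i j)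
filled? m u b j i = FP.any? (λ t → (toℕ j + toℕ t) % m ℕ.≟ toℕ (b i) % m)

columnCount : ∀ m .{{_ : NonZero m}} {N} → Word m N → BlockFn m N → Fin m → ℕ
columnCount m {N} u b j = length (filter (filled? m u b j) (allFin N))

EquitableColumn : ∀ m .{{_ : NonZero m}} {N} → Word m N → BlockFn m N → Fin m → Set
EquitableColumn m u b j =
  ((1 ≤ toℕ j × toℕ j ≤ ∣ u ∣w % m) → columnCount m u b j ≡ suc (∣ u ∣w / m)) ×
  ((toℕ j ≡ 0 ⊎ ∣ u ∣w % m < toℕ j) → columnCount m u b j ≡ ∣ u ∣w / m)

IsEquitable : ∀ m .{{_ : NonZero m}} {N} → Word m N → BlockFn m N → Set
IsEquitable m u b = IsPartition b × ((j : Fin m) → EquitableColumn m u b j)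

IsRightmostEquitable : ∀ m .{{_ : NonZero m}} {N} → Word m N → BlockFn m N → Set
IsRightmostEquitable m {N} u b =
  IsEquitable m u b ×
  ((v : BlockFn m N) → IsEquitable m u v → (i : Fin N) → b i F.≤ v i)

-- The removal process.  `rem` is the list of not-yet-removed positions in
-- left-to-right order; L is the current block index (as a natural < m).
-- Block L of remaining letters = filter (block = L) rem; its leftmost letter is
-- the head.  Update L := (L - x) mod m, computed as (L + (m ∸ x)) % m (x < m).
runProcess : ∀ m .{{_ : NonZero m}} {N} → Word m N → BlockFn m N →
             ℕ → List (Fin N) → ℕ → Bool
runProcess m u b zero rem L = true
runProcess m u b (suc k) rem L with filter (λ i → toℕ (b i) ℕ.≟ L) rem
... | [] = false
... | i ∷ _ = runProcess m u b k (filter (λ j → ¬? (j F.≟ i)) rem)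
                 ((L + (m ∸ toℕ (u i))) % m)

IsSuccessful : ∀ m .{{_ : NonZero m}} {N} → Word m N → BlockFn m N → Set
IsSuccessful m {N} u b = IsPartition b × runProcess m u b N (allFin N) (∣ u ∣w % m) ≡ true

{-# OPTIONS --safe #-}
module Submission where

-- The process on letters of total s starts at level s mod m and steps down through all residues of
-- s, s - 1, …, 1, so a successful partition is equitable.  Conversely an equitable partition can only
-- get stuck at level 0, with the leftover letters filling all columns equally often; the leftovers form
-- a suffix of each block and can be moved one block to the right, so the partition is not rightmost.
-- Finally let b be successful and v equitable.  Then w = min(b, v) is equitable, and if w ≠ b, the last
-- letter of the process that moves leads to a block whose remaining letters do not move, and the
-- column of that block gains a cell when passing from b to w, a contradiction.

open import Defs
open import Data.Nat
  using (ℕ; zero; suc; _+_; _*_; _∸_; _⊓_; _≤_; _<_; z≤n; s≤s; pred; NonZero; _≤?_)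
import Data.Nat as ℕ
open import Data.Nat.Properties hiding (_≤?_)
open import Data.Nat.DivMod
open import Data.Nat.ListAction using (sum)
open import Data.Nat.Tactic.RingSolver using (solve-∀)
open import Data.Fin using (Fin; toℕ; fromℕ<)
import Data.Fin as F
import Data.Fin.Properties as FP
open import Data.List using (List; []; _∷_; map; filter; length; allFin)
open import Data.List.Properties using (filter-all; filter-accept; filter-reject; length-tabulate)
open import Data.List.Relation.Unary.Any using (here; there)
import Data.List.Relation.Unary.All as All
open import Data.List.Relation.Unary.AllPairs using (AllPairs; []; _∷_)
import Data.List.Relation.Unary.AllPairs as AllPairs
import Data.List.Relation.Unary.AllPairs.Properties as AllPairs
open import Data.List.Relation.Unary.Unique.Propositional using (Unique)
import Data.List.Relation.Unary.Unique.Propositional.Properties as Unique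
open import Data.List.Membership.Propositional using (_∈_; _∉_)
open import Data.List.Membership.Propositional.Properties using (∈-filter⁺; ∈-filter⁻; ∈-allFin)
import Data.List.Membership.DecPropositional as DecMembership
open import Data.Product using (∃; _×_; _,_; proj₁; proj₂)
open import Data.Sum using (_⊎_; inj₁; inj₂)
open import Data.Bool using (true)
open import Function using (_∘_; id; case_of_)
open import Relation.Nullary using (Dec; yes; no; ¬_; contradiction)
open import Relation.Nullary.Decidable using (¬?; _×-dec_)
open import Relation.Unary using (Decidable)
open import Relation.Binary.PropositionalEquality

-- Finite sums over lists.

private
  variable
    A B : Set
    n : ℕ

left-comm : ∀ a b c → a + (b + c) ≡ b + (a + c)
left-comm = solve-∀

swap-assoc : ∀ a b c → a + b + c ≡ b + (a + c)
swap-assoc = solve-∀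

∑ : List A → (A → ℕ) → ℕ
∑ xs f = sum (map f xs)

∑-cong : ∀ (xs : List A) {f g : A → ℕ} → (∀ {x} → x ∈ xs → f x ≡ g x) → ∑ xs f ≡ ∑ xs g
∑-cong []       f≡g = refl
∑-cong (x ∷ xs) f≡g = cong₂ _+_ (f≡g (here refl)) (∑-cong xs (f≡g ∘ there))

∑-mono : ∀ (xs : List A) {f g : A → ℕ} → (∀ {x} → x ∈ xs → f x ≤ g x) → ∑ xs f ≤ ∑ xs g
∑-mono []       f≤g = z≤n
∑-mono (x ∷ xs) f≤g = +-mono-≤ (f≤g (here refl)) (∑-mono xs (f≤g ∘ there))

-- Both double counts end here: over the columns in `column-⊓`, over the positions in `run-minimal`.
∑-mono-equality : ∀ (xs : List A) {f g : A → ℕ} → (∀ {x} → x ∈ xs → f x ≤ g x) →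
                  ∑ xs f ≡ ∑ xs g → ∀ {x} → x ∈ xs → f x ≡ g x
∑-mono-equality (x ∷ xs) {f} {g} f≤g eq = λ where
    (here refl) → fx≡gx
    (there y∈)  → ∑-mono-equality xs (f≤g ∘ there)
                    (+-cancelˡ-≡ (f x) _ _ (trans eq (cong (_+ ∑ xs g) (sym fx≡gx)))) y∈
  where
  gx≤fx : g x ≤ f x
  gx≤fx = +-cancelʳ-≤ (∑ xs f) _ _
    (≤-trans (+-monoʳ-≤ (g x) (∑-mono xs (f≤g ∘ there))) (≤-reflexive (sym eq)))
  fx≡gx : f x ≡ g x
  fx≡gx = ≤-antisym (f≤g (here refl)) gx≤fx

∑-zero : ∀ (xs : List A) → ∑ xs (λ _ → 0) ≡ 0
∑-zero []       = refl
∑-zero (x ∷ xs) = ∑-zero xs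

∑-+ : ∀ (xs : List A) (f g : A → ℕ) → ∑ xs (λ x → f x + g x) ≡ ∑ xs f + ∑ xs g
∑-+ []       f g = refl
∑-+ (x ∷ xs) f g = trans (cong (f x + g x +_) (∑-+ xs f g)) (interchange (f x) (g x) _ _)
  where
  interchange : ∀ a b c d → (a + b) + (c + d) ≡ (a + c) + (b + d)
  interchange = solve-∀

∑-swap : ∀ (xs : List A) (ys : List B) (f : A → B → ℕ) →
         ∑ xs (λ x → ∑ ys (f x)) ≡ ∑ ys (λ y → ∑ xs (λ x → f x y))
∑-swap []       ys f = sym (∑-zero ys)
∑-swap (x ∷ xs) ys f = trans (cong (∑ ys (f x) +_) (∑-swap xs ys f))
                             (sym (∑-+ ys (f x) (λ y → ∑ xs (λ x → f x y))))

length≡∑1 : ∀ (xs : List A) → length xs ≡ ∑ xs (λ _ → 1)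
length≡∑1 []       = refl
length≡∑1 (x ∷ xs) = cong suc (length≡∑1 xs)

length-filter≡∑ : ∀ {P : A → Set} (P? : Decidable P) {f : A → ℕ} →
                  (∀ {x} → P x → f x ≡ 1) → (∀ {x} → ¬ P x → f x ≡ 0) →
                  ∀ xs → length (filter P? xs) ≡ ∑ xs f
length-filter≡∑ P? f≡1 f≡0 []       = refl
length-filter≡∑ P? f≡1 f≡0 (x ∷ xs) with P? x
... | yes px = cong₂ _+_ (sym (f≡1 px)) (length-filter≡∑ P? f≡1 f≡0 xs)
... | no ¬px = cong₂ _+_ (sym (f≡0 ¬px)) (length-filter≡∑ P? f≡1 f≡0 xs)

-- Removing one position from a list.

infixl 6 _∖_

_∖_ : List (Fin n) → Fin n → List (Fin n)
xs ∖ i = filter (λ j → ¬? (j F.≟ i)) xs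

∈-∖⁺ : ∀ {xs : List (Fin n)} {i j} → j ∈ xs → j ≢ i → j ∈ xs ∖ i
∈-∖⁺ = ∈-filter⁺ (λ j → ¬? (j F.≟ _))

∈-∖⁻ : ∀ {xs : List (Fin n)} {i j} → j ∈ xs ∖ i → j ∈ xs × j ≢ i
∈-∖⁻ {xs = xs} = ∈-filter⁻ (λ j → ¬? (j F.≟ _)) {xs = xs}

∑-∖ : ∀ {xs : List (Fin n)} {i} → Unique xs → i ∈ xs → ∀ f → ∑ xs f ≡ f i + ∑ (xs ∖ i) f
∑-∖ {xs = x ∷ xs} {i} (x∉xs ∷ _) (here refl) f = cong (λ ys → f i + ∑ ys f) (sym (trans
  (filter-reject (λ j → ¬? (j F.≟ i)) (λ ¬x≡x → ¬x≡x refl))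
  (filter-all (λ j → ¬? (j F.≟ i)) (All.map (λ x≢y y≡x → x≢y (sym y≡x)) x∉xs))))
∑-∖ {xs = x ∷ xs} {i} (x∉xs ∷ uxs) (there i∈xs) f = begin
  f x + ∑ xs f              ≡⟨ cong (f x +_) (∑-∖ uxs i∈xs f) ⟩
  f x + (f i + ∑ (xs ∖ i) f) ≡⟨ left-comm (f x) (f i) _ ⟩
  f i + (f x + ∑ (xs ∖ i) f) ≡⟨ cong (λ ys → f i + ∑ ys f)
                                 (filter-accept (λ j → ¬? (j F.≟ i)) (All.lookup x∉xs i∈xs)) ⟨
  f i + ∑ ((x ∷ xs) ∖ i) f   ∎
  where open ≡-Reasoning

-- Congruences modulo `m` and the cells filled by one letter.

module Columns (m : ℕ) .{{_ : NonZero m}} where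

  %-congˡ-+ : ∀ a {b c} → b % m ≡ c % m → (a + b) % m ≡ (a + c) % m
  %-congˡ-+ a {b} {c} eq = begin
    (a + b) % m          ≡⟨ %-distribˡ-+ a b m ⟩
    (a % m + b % m) % m  ≡⟨ cong (λ z → (a % m + z) % m) eq ⟩
    (a % m + c % m) % m  ≡⟨ %-distribˡ-+ a c m ⟨
    (a + c) % m          ∎
    where open ≡-Reasoning

  %-congʳ-+ : ∀ a {b c} → b % m ≡ c % m → (b + a) % m ≡ (c + a) % m
  %-congʳ-+ a {b} {c} eq = subst₂ (λ x y → x % m ≡ y % m) (+-comm a b) (+-comm a c) (%-congˡ-+ a eq)

  suc-%-cancel : ∀ {b c} → suc b % m ≡ suc c % m → b % m ≡ c % m
  suc-%-cancel {b} {c} eq = begin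
    b % m                 ≡⟨ lift b ⟩
    (pred m + suc b) % m  ≡⟨ %-congˡ-+ (pred m) eq ⟩
    (pred m + suc c) % m  ≡⟨ lift c ⟨
    c % m                 ∎
    where
    open ≡-Reasoning
    lift : ∀ b → b % m ≡ (pred m + suc b) % m
    lift b = sym (trans (cong (_% m) (trans (+-suc (pred m) b)
      (trans (cong (_+ b) (suc-pred m)) (+-comm m b)))) ([m+n]%n≡m%n b m))

  %-cancelˡ-+ : ∀ a {b c} → (a + b) % m ≡ (a + c) % m → b % m ≡ c % m
  %-cancelˡ-+ zero    eq = eq
  %-cancelˡ-+ (suc a) eq = %-cancelˡ-+ a (suc-%-cancel eq)

  %-injective : ∀ {b c} → b < m → c < m → b % m ≡ c % m → b ≡ c
  %-injective b<m c<m eq = trans (sym (m<n⇒m%n≡m b<m)) (trans eq (m<n⇒m%n≡m c<m))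

  δ : ℕ → ℕ → ℕ
  δ a b with a % m ℕ.≟ b % m
  ... | yes _ = 1
  ... | no _  = 0

  δ-yes : ∀ {a b} → a % m ≡ b % m → δ a b ≡ 1
  δ-yes {a} {b} eq with a % m ℕ.≟ b % m
  ... | yes _ = refl
  ... | no ne = contradiction eq ne

  δ-no : ∀ {a b} → a % m ≢ b % m → δ a b ≡ 0
  δ-no {a} {b} ne with a % m ℕ.≟ b % m
  ... | yes eq = contradiction eq ne
  ... | no _   = refl

  δ-⇔ : ∀ {a b c d} → (a % m ≡ b % m → c % m ≡ d % m) → (c % m ≡ d % m → a % m ≡ b % m) →
        δ a b ≡ δ c d
  δ-⇔ {a} {b} {c} {d} f g with c % m ℕ.≟ d % m
  ... | yes eq = δ-yes (g eq)
  ... | no ne  = δ-no (ne ∘ f)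

  -- The number of t < x with j + t ≡ k (mod m).  For x ≤ m it is 0 or 1, and it is 1 exactly when
  -- a letter x in block k fills column j; column m is column 0.
  fill : ℕ → ℕ → ℕ → ℕ
  fill j k zero    = 0
  fill j k (suc x) = δ (j + x) k + fill j k x

  fill-cong : ∀ {j j′ k k′} → j % m ≡ j′ % m → k % m ≡ k′ % m → ∀ x → fill j k x ≡ fill j′ k′ x
  fill-cong j≡ k≡ zero    = refl
  fill-cong {j} {j′} j≡ k≡ (suc x) = cong₂ _+_
    (δ-⇔ (λ eq → trans (sym (%-congʳ-+ x j≡)) (trans eq k≡))
         (λ eq → trans (%-congʳ-+ x j≡) (trans eq (sym k≡))))
    (fill-cong j≡ k≡ x)

  fill-suc-suc : ∀ j k x → fill (suc j) (suc k) x ≡ fill j k x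
  fill-suc-suc j k zero    = refl
  fill-suc-suc j k (suc x) = cong₂ _+_ (δ-⇔ suc-%-cancel (%-congˡ-+ 1)) (fill-suc-suc j k x)

  fill-+-+ : ∀ d j k x → fill (d + j) (d + k) x ≡ fill j k x
  fill-+-+ zero    j k x = refl
  fill-+-+ (suc d) j k x = trans (fill-suc-suc (d + j) (d + k) x) (fill-+-+ d j k x)

  -- Only the cyclic distance `a` from the column up to the block matters; the value is then decided
  -- by comparing `a` with `x`.
  fill-congruent : ∀ {j k a} → (j + a) % m ≡ k % m → ∀ x → fill j k x ≡ fill 0 a x
  fill-congruent {j} {k} {a} eq x = begin
    fill j k x              ≡⟨ fill-cong (cong (_% m) (sym (+-identityʳ j))) (sym eq) x ⟩
    fill (j + 0) (j + a) x  ≡⟨ fill-+-+ j 0 a x ⟩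
    fill 0 a x              ∎
    where open ≡-Reasoning

  fill0≡0 : ∀ {a x} → a < m → x ≤ a → fill 0 a x ≡ 0
  fill0≡0 {a} {zero}  a<m x<a = refl
  fill0≡0 {a} {suc x} a<m x<a = cong₂ _+_
    (δ-no (<⇒≢ x<a ∘ %-injective (<-trans x<a a<m) a<m))
    (fill0≡0 a<m (<⇒≤ x<a))

  fill0≡1 : ∀ {a x} → a < x → x ≤ m → fill 0 a x ≡ 1
  fill0≡1 {a} {suc x} (s≤s a≤x) x<m with m≤n⇒m<n∨m≡n a≤x
  ... | inj₁ a<x  = cong₂ _+_ (δ-no (<⇒≢ a<x ∘ sym ∘ %-injective x<m (<-trans a<x x<m)))
                              (fill0≡1 a<x (<⇒≤ x<m))
  ... | inj₂ refl = cong₂ _+_ (δ-yes refl) (fill0≡0 x<m ≤-refl)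

  -- a is the cyclic distance from column j up to block k.
  Offset : ℕ → ℕ → ℕ → Set
  Offset j k a = a < m × (j + a ≡ k ⊎ j + a ≡ k + m)

  offset-% : ∀ {j k a} → Offset j k a → (j + a) % m ≡ k % m
  offset-% (_ , inj₁ eq) = cong (_% m) eq
  offset-% {k = k} (_ , inj₂ eq) = trans (cong (_% m) eq) ([m+n]%n≡m%n k m)

  offset : ∀ {j k} → j < m → k < m → ∃ (Offset j k)
  offset {j} {k} j<m k<m with j ≤? k
  ... | yes j≤k = k ∸ j , ≤-<-trans (m∸n≤m k j) k<m , inj₁ (m+[n∸m]≡n j≤k)
  ... | no  j≰k = (k + m) ∸ j
                , m<n+o⇒m∸n<o (k + m) j (+-monoˡ-< m (≰⇒> j≰k))
                , inj₂ (m+[n∸m]≡n (≤-trans (<⇒≤ j<m) (m≤n+m m k)))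

  -- The condition `j ≤ v → j ≤ w` says that the move from `v` to `w` does not jump over column `j`.
  -- It excludes the one bad case, where only the distance up to `w` wraps around.
  offset-mono-< : ∀ {j v w a a′} → Offset j w a → Offset j v a′ → (j ≤ v → j ≤ w) → w < v → a < a′
  offset-mono-< {j} (_ , inj₁ p) (_ , inj₁ q) _ w<v =
    +-cancelˡ-< j _ _ (subst₂ _<_ (sym p) (sym q) w<v)
  offset-mono-< {j} (_ , inj₁ p) (_ , inj₂ q) _ w<v =
    +-cancelˡ-< j _ _ (subst₂ _<_ (sym p) (sym q) (<-≤-trans w<v (m≤m+n _ m)))
  offset-mono-< {j} {v} {w} (a<m , inj₂ p) (_ , inj₁ q) cut w<v =
    contradiction (+-cancelˡ-≤ j _ _ (≤-trans (+-monoˡ-≤ m (cut (subst (j ≤_) q (m≤m+n j _))))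
                                              (≤-reflexive (sym p))))
                  (<⇒≱ a<m)
  offset-mono-< {j} (_ , inj₂ p) (_ , inj₂ q) _ w<v =
    +-cancelˡ-< j _ _ (subst₂ _<_ (sym p) (sym q) (+-monoˡ-< m w<v))

  -- Moving a letter to the right without passing column j can only make it fill column j.
  fill-anti : ∀ {j v w x} → j < m → v < m → w ≤ v → x ≤ m → (j ≤ v → j ≤ w) →
              fill j v x ≤ fill j w x
  fill-anti {j} {v} {w} {x} j<m v<m w≤v x≤m cut with m≤n⇒m<n∨m≡n w≤v
  ... | inj₂ refl = ≤-refl
  ... | inj₁ w<v with offset j<m (<-trans w<v v<m) | offset j<m v<m
  ...   | a , o | a′ , o′ with offset-mono-< o o′ cut w<v | x ≤? a′
  ...     | a<a′ | yes x≤a′ = subst (_≤ fill j w x)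
      (sym (trans (fill-congruent (offset-% o′) x) (fill0≡0 (proj₁ o′) x≤a′))) z≤n
  ...     | a<a′ | no x≰a′  = ≤-reflexive (trans
      (trans (fill-congruent (offset-% o′) x) (fill0≡1 (≰⇒> x≰a′) x≤m))
      (sym (trans (fill-congruent (offset-% o) x) (fill0≡1 (<-trans a<a′ (≰⇒> x≰a′)) x≤m))))

  -- A letter x in block v stops just before column j = v ∸ x (mod m); from any block further right
  -- on the same side of j it reaches column j.
  fill-strict : ∀ {j v w x} → j < m → v < m → x < m → (j + x) % m ≡ v % m → w < v →
                (j ≤ v → j ≤ w) → fill j v x < fill j w x
  fill-strict {j} {v} {w} {x} j<m v<m x<m j+x≡v w<v cut
    with offset j<m (<-trans w<v v<m) | offset j<m v<m
  ... | a , o | a′ , o′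
    with offset-mono-< o o′ cut w<v
       | %-injective (proj₁ o′) x<m (%-cancelˡ-+ j (trans (offset-% o′) (sym j+x≡v)))
  ... | a<x | refl = subst₂ _<_
    (sym (trans (fill-congruent j+x≡v x) (fill0≡0 x<m ≤-refl)))
    (sym (trans (fill-congruent (offset-% o) x) (fill0≡1 a<x (<⇒≤ x<m))))
    (s≤s z≤n)

  -- The recursion of `fill` splits off the largest `t`; splitting off `t = 0` instead leaves a
  -- count for the next column.
  fill-sucʳ : ∀ j k x → fill j k (suc x) ≡ δ j k + fill (suc j) k x
  fill-sucʳ j k zero    = cong (λ z → δ z k + 0) (+-identityʳ j)
  fill-sucʳ j k (suc x) = begin
    δ (j + suc x) k + fill j k (suc x)
      ≡⟨ cong₂ _+_ (cong (λ z → δ z k) (+-suc j x)) (fill-sucʳ j k x) ⟩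
    δ (suc j + x) k + (δ j k + fill (suc j) k x)
      ≡⟨ left-comm (δ (suc j + x) k) (δ j k) _ ⟩
    δ j k + fill (suc j) k (suc x) ∎
    where open ≡-Reasoning

  -- Cells are filled downward from the letter's own block, so column `j` is reached only through
  -- column `suc j` unless the letter starts there.
  fill-leave : ∀ {j k} → j % m ≢ k % m → ∀ x → fill j k x ≤ fill (suc j) k x
  fill-leave {j} {k} j≢k x = begin
    fill j k x                ≤⟨ m≤n+m _ (δ (j + x) k) ⟩
    fill j k (suc x)          ≡⟨ fill-sucʳ j k x ⟩
    δ j k + fill (suc j) k x  ≡⟨ cong (_+ fill (suc j) k x) (δ-no j≢k) ⟩
    fill (suc j) k x          ∎
    where open ≤-Reasoning

  -- Residue counts as the heights of equitable columns.

  -- The number of integers in 1, ..., s congruent to `j`. Unlike a formula with quotient and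
  -- remainder, it changes by a single `fill` when a letter is removed.
  residueCount : ℕ → ℕ → ℕ
  residueCount j zero    = 0
  residueCount j (suc s) = δ j (suc s) + residueCount j s

  -- From level `x + s` a letter `x` fills the residues of s + 1, ..., s + x, and those of 1, ..., s
  -- remain.
  residueCount-+ : ∀ j x s → fill j (x + s) x + residueCount j s ≡ residueCount j (x + s)
  residueCount-+ j x s = go x s refl
    where
    open ≡-Reasoning
    -- The block `k` stays fixed while the terms pass one by one from `fill` to `residueCount`.
    go : ∀ x s {k} → x + s ≡ k → fill j k x + residueCount j s ≡ residueCount j k
    go zero    s refl = refl
    go (suc x) s {k} eq = begin
      δ (j + x) k + fill j k x + residueCount j s    ≡⟨ cong (λ z → z + fill j k x + residueCount j s) δ≡ ⟩
      δ j (suc s) + fill j k x + residueCount j s    ≡⟨ swap-assoc (δ j (suc s)) (fill j k x) _ ⟩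
      fill j k x + (δ j (suc s) + residueCount j s)  ≡⟨ go x (suc s) (trans (+-suc x s) eq) ⟩
      residueCount j k                               ∎
      where
      k≡ : x + suc s ≡ k
      k≡ = trans (+-suc x s) eq
      δ≡ : δ (j + x) k ≡ δ j (suc s)
      δ≡ = δ-⇔ (λ p → %-cancelˡ-+ x (trans (cong (_% m) (+-comm x j)) (trans p (cong (_% m) (sym k≡)))))
               (λ p → trans (cong (_% m) (+-comm j x)) (trans (%-congˡ-+ x p) (cong (_% m) k≡)))

  ∑-δ : ∀ s → ∑ (allFin m) (λ j → δ (toℕ j) s) ≡ 1
  ∑-δ s = begin
    ∑ (allFin m) (λ j → δ (toℕ j) s)
      ≡⟨ ∑-∖ (Unique.allFin⁺ m) (∈-allFin r) _ ⟩
    δ (toℕ r) s + ∑ (allFin m ∖ r) (λ j → δ (toℕ j) s)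
      ≡⟨ cong₂ _+_ (δ-yes r≡s) (trans (∑-cong (allFin m ∖ r) off) (∑-zero (allFin m ∖ r))) ⟩
    1 ∎
    where
    open ≡-Reasoning
    r = fromℕ< (m%n<n s m)
    r≡s : toℕ r % m ≡ s % m
    r≡s = trans (cong (_% m) (FP.toℕ-fromℕ< (m%n<n s m))) (m%n%n≡m%n s m)
    off : ∀ {j} → j ∈ allFin m ∖ r → δ (toℕ j) s ≡ 0
    off j∈ = δ-no λ eq → proj₂ (∈-∖⁻ {xs = allFin m} j∈)
      (FP.toℕ-injective (%-injective (FP.toℕ<n _) (FP.toℕ<n r) (trans eq (sym r≡s))))

  ∑-residueCount : ∀ s → ∑ (allFin m) (λ j → residueCount (toℕ j) s) ≡ s
  ∑-residueCount zero    = ∑-zero (allFin m)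
  ∑-residueCount (suc s) = trans (∑-+ (allFin m) _ _) (cong₂ _+_ (∑-δ (suc s)) (∑-residueCount s))

  -- A letter x whose block is congruent to x + s accounts for the residues of s + 1, …, s + x.
  ∑-fill : ∀ k x → ∑ (allFin m) (λ j → fill (toℕ j) k x) ≡ x
  ∑-fill k x = +-cancelʳ-≡ s _ _ (begin
    ∑ (allFin m) (λ j → fill (toℕ j) k x) + s
      ≡⟨ cong₂ _+_ (∑-cong (allFin m) (λ _ → fill-cong refl (sym lift) x)) (sym (∑-residueCount s)) ⟩
    ∑ (allFin m) (λ j → fill (toℕ j) (x + s) x) + ∑ (allFin m) (λ j → residueCount (toℕ j) s)
      ≡⟨ ∑-+ (allFin m) _ _ ⟨
    ∑ (allFin m) (λ j → fill (toℕ j) (x + s) x + residueCount (toℕ j) s)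
      ≡⟨ ∑-cong (allFin m) (λ _ → residueCount-+ _ x s) ⟩
    ∑ (allFin m) (λ j → residueCount (toℕ j) (x + s))
      ≡⟨ ∑-residueCount (x + s) ⟩
    x + s ∎)
    where
    open ≡-Reasoning
    -- Chosen so that `x + s` equals `k + x * m`, which is congruent to `k`.
    s = k + (x * m ∸ x)
    lift : (x + s) % m ≡ k % m
    lift = trans (cong (_% m) (begin
      x + (k + (x * m ∸ x))  ≡⟨ left-comm x k _ ⟩
      k + (x + (x * m ∸ x))  ≡⟨ cong (k +_) (m+[n∸m]≡n (m≤m*n x m)) ⟩
      k + x * m              ∎)) ([m+kn]%n≡m%n k x m)

  -- Each residue occurs once among `m` consecutive integers: a letter of value `m` would fill every
  -- column once.
  residueCount-period : ∀ {j} → j < m → ∀ s → residueCount j (m + s) ≡ suc (residueCount j s)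
  residueCount-period {j} j<m s with offset j<m (m%n<n s m)
  ... | a , o = trans (sym (residueCount-+ j m s)) (cong (_+ residueCount j s)
    (trans (fill-congruent (trans (offset-% o) (trans (m%n%n≡m%n s m)
             (sym (trans (cong (_% m) (+-comm m s)) ([m+n]%n≡m%n s m))))) m)
           (fill0≡1 (proj₁ o) ≤-refl)))

  residueCount-periods : ∀ {j} → j < m → ∀ q s → residueCount j (q * m + s) ≡ q + residueCount j s
  residueCount-periods j<m zero    s = refl
  residueCount-periods {j} j<m (suc q) s = trans (cong (residueCount j) (+-assoc m (q * m) s))
    (trans (residueCount-period j<m (q * m + s)) (cong suc (residueCount-periods j<m q s)))

  residueCount-fill : ∀ j s → residueCount j s ≡ fill j s s
  residueCount-fill j s = begin
    residueCount j s                          ≡⟨ cong (residueCount j) (+-identityʳ s) ⟨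
    residueCount j (s + 0)                    ≡⟨ residueCount-+ j s 0 ⟨
    fill j (s + 0) s + 0                      ≡⟨ +-identityʳ _ ⟩
    fill j (s + 0) s                          ≡⟨ cong (λ k → fill j k s) (+-identityʳ s) ⟩
    fill j s s                                ∎
    where open ≡-Reasoning

  residueCount-divMod : ∀ {j} → j < m → ∀ s → residueCount j s ≡ s / m + fill j (s % m) (s % m)
  residueCount-divMod {j} j<m s = begin
    residueCount j s                        ≡⟨ cong (residueCount j) (trans (m≡m%n+[m/n]*n s m) (+-comm (s % m) _)) ⟩
    residueCount j (s / m * m + s % m)      ≡⟨ residueCount-periods j<m (s / m) (s % m) ⟩
    s / m + residueCount j (s % m)          ≡⟨ cong (s / m +_) (residueCount-fill j (s % m)) ⟩
    s / m + fill j (s % m) (s % m)          ∎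
    where open ≡-Reasoning

  -- The incomplete period 1, ..., s % m gives one extra cell to exactly these columns. Together
  -- with `residueCount-high` this recovers the heights in `EquitableColumn`.
  residueCount-low : ∀ {j s} → 1 ≤ j → j ≤ s % m → residueCount j s ≡ suc (s / m)
  residueCount-low {j@(suc _)} {s} 1≤j j≤r = trans (residueCount-divMod (≤-<-trans j≤r r<m) s)
    (trans (cong (s / m +_) (trans
      (fill-congruent (cong (_% m) (m+[n∸m]≡n j≤r)) (s % m))
      (fill0≡1 (∸-monoʳ-< (s≤s z≤n) j≤r) (<⇒≤ r<m))))
    (+-comm (s / m) 1))
    where
    r<m = m%n<n s m

  residueCount-high : ∀ {j s} → j < m → j ≡ 0 ⊎ s % m < j → residueCount j s ≡ s / m
  residueCount-high {j} {s} j<m high = trans (residueCount-divMod j<m s)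
    (trans (cong (s / m +_) (empty high)) (+-identityʳ _))
    where
    r<m = m%n<n s m
    empty : j ≡ 0 ⊎ s % m < j → fill j (s % m) (s % m) ≡ 0
    empty (inj₁ refl) = fill0≡0 r<m ≤-refl
    empty (inj₂ r<j) with offset j<m r<m
    ... | a , o@(a<m , inj₁ eq) = contradiction (subst (j ≤_) eq (m≤m+n j a)) (<⇒≱ r<j)
    ... | a , o@(a<m , inj₂ eq) = trans (fill-congruent (offset-% o) (s % m)) (fill0≡0 a<m
      (+-cancelˡ-≤ j _ _ (≤-trans (+-monoˡ-≤ (s % m) (<⇒≤ j<m))
        (≤-reflexive (trans (+-comm m _) (sym eq))))))

-- Column counts of a word, and minima of balanced block functions.

module Process (m N : ℕ) .{{_ : NonZero m}} (u : Word m N) where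

  open Columns m

  positions : List (Fin N)
  positions = allFin N

  letter : Fin N → ℕ
  letter i = toℕ (u i)

  letter≤m : ∀ i → letter i ≤ m
  letter≤m i = <⇒≤ (FP.toℕ<n (u i))

  column : (Fin N → ℕ) → List (Fin N) → ℕ → ℕ
  column c xs j = ∑ xs (λ i → fill j (c i) (letter i))

  Antitone : (Fin N → ℕ) → Set
  Antitone c = ∀ i j → toℕ i ≤ toℕ j → c j ≤ c i

  -- Formulated for any list of positions and its own total, so that it can be followed through the
  -- removal process; blocks are natural numbers so that minima can be taken directly.
  Balanced : (Fin N → ℕ) → List (Fin N) → Set
  Balanced c xs = ∀ j → j < m → column c xs j ≡ residueCount j (∑ xs letter)

  columnCount≡column : ∀ b j → columnCount m u b j ≡ column (toℕ ∘ b) positions (toℕ j)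
  columnCount≡column b j = length-filter≡∑ (filled? m u b j) filled empty positions
    where
    filled : ∀ {i} → Filled m u b i j → fill (toℕ j) (toℕ (b i)) (letter i) ≡ 1
    filled {i} (t , eq) = trans (fill-congruent eq (letter i)) (fill0≡1 (FP.toℕ<n t) (letter≤m i))
    empty : ∀ {i} → ¬ Filled m u b i j → fill (toℕ j) (toℕ (b i)) (letter i) ≡ 0
    empty {i} ¬f with offset (FP.toℕ<n j) (FP.toℕ<n (b i))
    ... | a , o with letter i ≤? a
    ...   | yes x≤a = trans (fill-congruent (offset-% o) (letter i)) (fill0≡0 (proj₁ o) x≤a)
    ...   | no  x≰a = contradiction
      (fromℕ< a<x , trans (cong (λ t → (toℕ j + t) % m) (FP.toℕ-fromℕ< a<x)) (offset-% o)) ¬f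
      where
      a<x = ≰⇒> x≰a

  balanced⇒equitableColumn : ∀ b → Balanced (toℕ ∘ b) positions → ∀ j → EquitableColumn m u b j
  balanced⇒equitableColumn b bal j =
      (λ (1≤j , j≤r) → trans count (residueCount-low 1≤j j≤r))
    , (λ high → trans count (residueCount-high (FP.toℕ<n j) high))
    where
    count = trans (columnCount≡column b j) (bal (toℕ j) (FP.toℕ<n j))

  equitable⇒balanced : ∀ b → IsEquitable m u b → Balanced (toℕ ∘ b) positions
  equitable⇒balanced b (_ , eq) j j<m = trans
    (trans (cong (column _ positions) (sym j′≡j)) (sym (columnCount≡column b j′)))
    (trans (count (toℕ j′ ≤? ∣ u ∣w % m) (toℕ j′ ℕ.≟ 0)) (cong (λ k → residueCount k ∣ u ∣w) j′≡j))
    where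
    j′ = fromℕ< j<m
    j′≡j = FP.toℕ-fromℕ< j<m
    j′<m = FP.toℕ<n j′
    count : Dec (toℕ j′ ≤ ∣ u ∣w % m) → Dec (toℕ j′ ≡ 0) →
            columnCount m u b j′ ≡ residueCount (toℕ j′) ∣ u ∣w
    count _         (yes j≡0) = trans (proj₂ (eq j′) (inj₁ j≡0)) (sym (residueCount-high j′<m (inj₁ j≡0)))
    count (yes j≤r) (no j≢0)  = trans (proj₁ (eq j′) (n≢0⇒n>0 j≢0 , j≤r)) (sym (residueCount-low (n≢0⇒n>0 j≢0) j≤r))
    count (no j≰r)  (no _)    = trans (proj₂ (eq j′) (inj₂ (≰⇒> j≰r))) (sym (residueCount-high j′<m (inj₂ (≰⇒> j≰r))))

  -- A letter fills as many cells as its value in whichever block it lies.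
  column-total : ∀ c → ∑ (allFin m) (λ j → column c positions (toℕ j)) ≡ ∣ u ∣w
  column-total c = trans (∑-swap (allFin m) positions _)
                         (∑-cong positions (λ {i} _ → ∑-fill (c i) (letter i)))

  -- Every column has the upper cut of one of the two partitions in common with their minimum, so
  -- it only gains filled cells; since the total is fixed, nothing changes.
  column-⊓ : ∀ {b v} → Antitone b → Antitone v → (∀ i → b i < m) → (∀ i → v i < m) →
             Balanced b positions → Balanced v positions → Balanced (λ i → b i ⊓ v i) positions
  column-⊓ {b} {v} anti-b anti-v b<m v<m bal-b bal-v j j<m = sym (subst
    (λ k → residueCount k ∣ u ∣w ≡ column w positions k) (FP.toℕ-fromℕ< j<m)
    (∑-mono-equality (allFin m) (λ {j} _ → gain (toℕ j) (FP.toℕ<n j))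
      (trans (∑-residueCount ∣ u ∣w) (sym (column-total w))) (∈-allFin (fromℕ< j<m))))
    where
    w : Fin N → ℕ
    w i = b i ⊓ v i
    gain-cut : ∀ {c} j → j < m → (∀ i → c i < m) → (∀ i → w i ≤ c i) → Balanced c positions →
               (∀ i → j ≤ c i → j ≤ w i) → residueCount j ∣ u ∣w ≤ column w positions j
    gain-cut j j<m c<m w≤c bal cut = subst (_≤ column w positions j) (bal j j<m)
      (∑-mono positions λ {i} _ → fill-anti j<m (c<m i) (w≤c i) (letter≤m i) (cut i))
    gain : ∀ j → j < m → residueCount j ∣ u ∣w ≤ column w positions j
    -- The positions with `j ≤ b i` and those with `j ≤ v i` are both initial segments, so one
    -- contains the other; the shorter one is the cut of the minimum.
    gain j j<m with FP.any? (λ i → (j ≤? b i) ×-dec ¬? (j ≤? v i))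
    ... | no  none = gain-cut j j<m b<m (λ i → m⊓n≤m _ _) bal-b cut
      where
      cut : ∀ i → j ≤ b i → j ≤ w i
      cut i j≤b with j ≤? v i
      ... | yes j≤v = ⊓-glb j≤b j≤v
      ... | no  j≰v = contradiction (i , j≤b , j≰v) none
    ... | yes (i , j≤b , j≰v) = gain-cut j j<m v<m (λ i → m⊓n≤n (b i) _) bal-v cut
      where
      cut : ∀ k → j ≤ v k → j ≤ w k
      cut k j≤v with ≤-total (toℕ i) (toℕ k)
      ... | inj₁ i≤k = contradiction (≤-trans j≤v (anti-v i k i≤k)) j≰v
      ... | inj₂ k≤i = ⊓-glb (≤-trans j≤b (anti-b k i k≤i)) j≤v

  -- Runs of the removal process.

  module _ (b : BlockFn m N) where

    block : Fin N → ℕ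
    block i = toℕ (b i)

    block<m : ∀ i → block i < m
    block<m i = FP.toℕ<n (b i)

    IsHead : Fin N → List (Fin N) → ℕ → Set
    IsHead i rem L = i ∈ rem × block i ≡ L × (∀ {j} → j ∈ rem → block j ≡ L → toℕ i ≤ toℕ j)

    next : ℕ → Fin N → ℕ
    next L i = (L + (m ∸ letter i)) % m

    -- A completed process as a derivation, so that proofs recurse on the removed letters instead of
    -- a counter and a Boolean.
    data Run : List (Fin N) → ℕ → Set where
      done : ∀ {L} → Run [] L
      step : ∀ {rem L} i → IsHead i rem L → Run (rem ∖ i) (next L i) → Run rem L

    Sorted : List (Fin N) → Set
    Sorted = AllPairs F._<_

    sorted⇒unique : ∀ {xs} → Sorted xs → Unique xs
    sorted⇒unique = AllPairs.map FP.<⇒≢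

    sorted-∖ : ∀ {xs} → Sorted xs → ∀ i → Sorted (xs ∖ i)
    sorted-∖ sorted i = AllPairs.filter⁺ (λ j → ¬? (j F.≟ i)) sorted

    positions-sorted : Sorted positions
    positions-sorted = AllPairs.tabulate⁺-< id

    filter-head : ∀ {rem L i xs} → Sorted rem → filter (λ j → block j ℕ.≟ L) rem ≡ i ∷ xs → IsHead i rem L
    filter-head {rem} {L} {i} {xs} sorted eq = proj₁ i∈ , proj₂ i∈ , least
      where
      P? = λ j → block j ℕ.≟ L
      i∈ : i ∈ rem × block i ≡ L
      i∈ = ∈-filter⁻ P? {xs = rem} (subst (i ∈_) (sym eq) (here refl))
      least : ∀ {j} → j ∈ rem → block j ≡ L → toℕ i ≤ toℕ j
      least j∈ bj≡L with subst (_ ∈_) eq (∈-filter⁺ P? j∈ bj≡L)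
                       | subst Sorted eq (AllPairs.filter⁺ P? sorted)
      ... | here refl  | _          = ≤-refl
      ... | there j∈xs | i<xs ∷ _ = <⇒≤ (All.lookup i<xs j∈xs)

    length-∖ : ∀ {k rem i} → Sorted rem → i ∈ rem → length rem ≡ suc k → length (rem ∖ i) ≡ k
    length-∖ {k} {rem} {i} sorted i∈ len = suc-injective (begin
      suc (length (rem ∖ i))       ≡⟨ cong suc (length≡∑1 (rem ∖ i)) ⟩
      1 + ∑ (rem ∖ i) (λ _ → 1)    ≡⟨ ∑-∖ (sorted⇒unique sorted) i∈ _ ⟨
      ∑ rem (λ _ → 1)              ≡⟨ length≡∑1 rem ⟨
      length rem                   ≡⟨ len ⟩
      suc k                        ∎)
      where open ≡-Reasoning

    runProcess⇒Run : ∀ k rem L → Sorted rem → length rem ≡ k →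
                     runProcess m u b k rem L ≡ true → Run rem L
    runProcess⇒Run zero    []  L sorted len ok = done
    runProcess⇒Run (suc k) rem L sorted len ok with filter (λ i → block i ℕ.≟ L) rem in eq
    ... | i ∷ _ = step i head
          (runProcess⇒Run k (rem ∖ i) _ (sorted-∖ sorted i) (length-∖ sorted (proj₁ head) len) ok)
      where
      head = filter-head sorted eq

    -- The invariant of the process: the level is the remaining total modulo `m`, since both fall by
    -- the removed letter.
    next-% : ∀ {rem i} → Unique rem → i ∈ rem →
             next (∑ rem letter % m) i ≡ ∑ (rem ∖ i) letter % m
    next-% {rem} {i} uniq i∈ = begin
      (∑ rem letter % m + (m ∸ x)) % m  ≡⟨ %-congʳ-+ (m ∸ x) (m%n%n≡m%n (∑ rem letter) m) ⟩
      (∑ rem letter + (m ∸ x)) % m      ≡⟨ cong (λ z → (z + (m ∸ x)) % m) (∑-∖ uniq i∈ letter) ⟩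
      (x + s + (m ∸ x)) % m             ≡⟨ cong (_% m) (swap-assoc x s (m ∸ x)) ⟩
      (s + (x + (m ∸ x))) % m           ≡⟨ cong (λ z → (s + z) % m) (m+[n∸m]≡n (letter≤m i)) ⟩
      (s + m) % m                       ≡⟨ [m+n]%n≡m%n s m ⟩
      s % m                             ∎
      where
      open ≡-Reasoning
      x = letter i
      s = ∑ (rem ∖ i) letter

    residueCount-∖ : ∀ {rem i} → Unique rem → i ∈ rem → block i ≡ ∑ rem letter % m → ∀ j →
      residueCount j (∑ rem letter) ≡ fill j (block i) (letter i) + residueCount j (∑ (rem ∖ i) letter)
    residueCount-∖ {rem} {i} uniq i∈ bi≡L j = begin
      residueCount j (∑ rem letter)     ≡⟨ cong (residueCount j) (∑-∖ uniq i∈ letter) ⟩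
      residueCount j (x + s)            ≡⟨ residueCount-+ j x s ⟨
      fill j (x + s) x + residueCount j s
        ≡⟨ cong (_+ residueCount j s) (fill-cong refl x+s≡bi x) ⟩
      fill j (block i) x + residueCount j s ∎
      where
      open ≡-Reasoning
      x = letter i
      s = ∑ (rem ∖ i) letter
      x+s≡bi : (x + s) % m ≡ block i % m
      x+s≡bi = trans (cong (_% m) (sym (∑-∖ uniq i∈ letter)))
                     (trans (sym (m%n%n≡m%n _ m)) (cong (_% m) (sym bi≡L)))

    run-balanced : ∀ {rem L} → Sorted rem → L ≡ ∑ rem letter % m → Run rem L → Balanced block rem
    run-balanced sorted L≡ done j j<m = refl
    run-balanced {rem} sorted refl (step i (i∈ , bi≡L , _) run) j j<m = begin
      column block rem j
        ≡⟨ ∑-∖ uniq i∈ _ ⟩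
      fill j (block i) (letter i) + column block (rem ∖ i) j
        ≡⟨ cong (fill j (block i) (letter i) +_)
             (run-balanced (sorted-∖ sorted i) (next-% uniq i∈) run j j<m) ⟩
      fill j (block i) (letter i) + residueCount j (∑ (rem ∖ i) letter)
        ≡⟨ residueCount-∖ uniq i∈ bi≡L j ⟨
      residueCount j (∑ rem letter) ∎
      where
      open ≡-Reasoning
      uniq = sorted⇒unique sorted

    -- The remaining letters form a suffix of each block, as leftmost letters go first.
    Closed : List (Fin N) → Set
    Closed rem = ∀ {i j} → i ∈ rem → toℕ i ≤ toℕ j → block i ≡ block j → j ∈ rem

    closed-∖ : ∀ {rem L i} → IsHead i rem L → Closed rem → Closed (rem ∖ i)
    closed-∖ {rem} {L} {i} (_ , bi≡L , least) closed {j} {k} j∈′ j≤k bj≡bk =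
      ∈-∖⁺ (closed j∈ j≤k bj≡bk) k≢i
      where
      j∈ = proj₁ (∈-∖⁻ {xs = rem} j∈′)
      j≢i = proj₂ (∈-∖⁻ {xs = rem} j∈′)
      k≢i : k ≢ i
      k≢i refl = j≢i (FP.toℕ-injective (≤-antisym j≤k (least j∈ (trans bj≡bk bi≡L))))

    -- If w ≤ block has the same columns, then the last letter i of the run with w i < block i
    -- would lead to a level L′ at which block and w have the same cut: the remaining part of
    -- block L′ is unmoved.  Then column L′ would gain the letter i in w without losing any.
    run-minimal : ∀ {w rem L} → IsPartition b → Antitone w → (∀ i → w i ≤ block i) →
                  (∀ j → j < m → column block positions j ≡ column w positions j) →
                  Closed rem → Sorted rem → L ≡ ∑ rem letter % m → Run rem L →
                  ∀ {i} → i ∈ rem → w i ≡ block i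
    run-minimal {w} {rem} part anti w≤b same closed sorted refl (step i head@(i∈ , bi≡L , _) run) {k} k∈
      with k F.≟ i
    ... | no  k≢i  = fixed (∈-∖⁺ k∈ k≢i)
      where
      fixed = run-minimal part anti w≤b same (closed-∖ head closed) (sorted-∖ sorted i)
                (next-% (sorted⇒unique sorted) i∈) run
    ... | yes refl with m≤n⇒m<n∨m≡n (w≤b i)
    ...   | inj₂ wi≡bi = wi≡bi
    ...   | inj₁ wi<bi = contradiction fill≡ (<⇒≢ fill<)
      where
      S′ = ∑ (rem ∖ i) letter
      L′ = S′ % m
      L′<m = m%n<n S′ m
      uniq = sorted⇒unique sorted
      next≡ = next-% uniq i∈
      fixed : ∀ {k} → k ∈ rem ∖ i → w k ≡ block k
      fixed = run-minimal part anti w≤b same (closed-∖ head closed) (sorted-∖ sorted i) next≡ run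
      -- Up to the head `h` of block `L′`, antitonicity gives `w k` at least `w h`, which is `L′`.
      -- After `h`, a position with block at least `L′` lies in block `L′`, so it is still remaining
      -- and unmoved.
      cut-head : ∀ {h} → IsHead h (rem ∖ i) (next (∑ rem letter % m) i) → ∀ k → L′ ≤ block k → L′ ≤ w k
      cut-head {h} (h∈ , bh≡ , _) k L′≤b with ≤-total (toℕ k) (toℕ h)
      ... | inj₁ k≤h = subst (_≤ w k) (trans (fixed h∈) (trans bh≡ next≡)) (anti k h k≤h)
      ... | inj₂ h≤k = subst (L′ ≤_) (sym (fixed (closed-∖ head closed h∈ h≤k bh≡bk))) L′≤b
        where
        bh≡bk : block h ≡ block k
        bh≡bk = ≤-antisym (subst (_≤ block k) (sym (trans bh≡ next≡)) L′≤b) (part h k h≤k)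
      -- The indices are freed by equations so that the run can be matched on. If nothing remains,
      -- `L′` is 0 and the cut is trivial.
      cut : ∀ {rem′ L″} → rem′ ≡ rem ∖ i → L″ ≡ next (∑ rem letter % m) i → Run rem′ L″ →
            ∀ k → L′ ≤ block k → L′ ≤ w k
      cut rem′≡ _ done k _ = ≤-trans
        (≤-reflexive (trans (cong (λ xs → ∑ xs letter % m) (sym rem′≡)) (m<n⇒m%n≡m (ℕ.>-nonZero⁻¹ m)))) z≤n
      cut refl refl (step h h-head _) = cut-head h-head
      letter-ends-at-L′ : (L′ + letter i) % m ≡ block i % m
      letter-ends-at-L′ = begin
        (S′ % m + letter i) % m    ≡⟨ %-congʳ-+ (letter i) (m%n%n≡m%n S′ m) ⟩
        (S′ + letter i) % m        ≡⟨ cong (_% m) (+-comm S′ (letter i)) ⟩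
        (letter i + S′) % m        ≡⟨ cong (_% m) (∑-∖ uniq i∈ letter) ⟨
        ∑ rem letter % m           ≡⟨ m%n%n≡m%n (∑ rem letter) m ⟨
        ∑ rem letter % m % m       ≡⟨ cong (_% m) bi≡L ⟨
        block i % m                ∎
        where open ≡-Reasoning
      fill< : fill L′ (block i) (letter i) < fill L′ (w i) (letter i)
      fill< = fill-strict L′<m (block<m i) (FP.toℕ<n (u i)) letter-ends-at-L′ wi<bi (cut refl refl run i)
      fill≡ : fill L′ (block i) (letter i) ≡ fill L′ (w i) (letter i)
      fill≡ = ∑-mono-equality positions
        (λ {k} _ → fill-anti L′<m (block<m k) (w≤b k) (letter≤m k) (cut refl refl run k))
        (same L′ L′<m) (∈-allFin i)

    successful⇒rightmost : IsSuccessful m u b → IsRightmostEquitable m u b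
    successful⇒rightmost (part , ok) = (part , balanced⇒equitableColumn b bal) , least
      where
      run : Run positions (∣ u ∣w % m)
      run = runProcess⇒Run N positions _ positions-sorted (length-tabulate id) ok
      bal = run-balanced positions-sorted refl run
      least : ∀ v → IsEquitable m u v → ∀ i → b i F.≤ v i
      least v eq@(part-v , _) i = ≤-trans (≤-reflexive (sym w≡b)) (m⊓n≤n (block i) (toℕ (v i)))
        where
        bal-w : Balanced (λ i → block i ⊓ toℕ (v i)) positions
        bal-w = column-⊓ part part-v block<m (FP.toℕ<n ∘ v) bal (equitable⇒balanced v eq)
        w≡b : block i ⊓ toℕ (v i) ≡ block i
        w≡b = run-minimal part (λ i j i≤j → ⊓-mono-≤ (part i j i≤j) (part-v i j i≤j))
                (λ i → m⊓n≤m _ _) (λ j j<m → trans (bal j j<m) (sym (bal-w j j<m)))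
                (λ {_} {j} _ _ _ → ∈-allFin j) positions-sorted refl run (∈-allFin i)

    -- Where the process can get stuck.

    balanced-∖ : ∀ {rem i} → Unique rem → i ∈ rem → block i ≡ ∑ rem letter % m →
                 Balanced block rem → Balanced block (rem ∖ i)
    balanced-∖ {rem} {i} uniq i∈ bi≡L bal j j<m = +-cancelˡ-≡ (fill j (block i) (letter i)) _ _
      (trans (sym (∑-∖ uniq i∈ _)) (trans (bal j j<m) (residueCount-∖ uniq i∈ bi≡L j)))

    -- ∑ f − ∑ g over all positions equals ∑ f − ∑ g over rem, when f and g agree off rem.
    Localizes : List (Fin N) → Set
    Localizes rem = ∀ f g → (∀ i → i ∉ rem → f i ≡ g i) →
                    ∑ positions f + ∑ rem g ≡ ∑ positions g + ∑ rem f

    localizes-∖ : ∀ {rem i} → Unique rem → i ∈ rem → Localizes rem → Localizes (rem ∖ i)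
    localizes-∖ {rem} {i} uniq i∈ loc f g f≡g = +-cancelʳ-≡ (f i) _ _ (begin
      ∑ positions f + ∑ (rem ∖ i) g + f i    ≡⟨ rotate (∑ positions f) _ (f i) ⟩
      ∑ positions f + (f i + ∑ (rem ∖ i) g)  ≡⟨ cong (λ z → ∑ positions f + (z + ∑ (rem ∖ i) g)) fi≡gi ⟩
      ∑ positions f + (g i + ∑ (rem ∖ i) g)  ≡⟨ cong (∑ positions f +_) (∑-∖ uniq i∈ g) ⟨
      ∑ positions f + ∑ rem g                ≡⟨ loc f g (λ j j∉ → f≡g j (j∉ ∘ proj₁ ∘ ∈-∖⁻ {xs = rem})) ⟩
      ∑ positions g + ∑ rem f                ≡⟨ cong (∑ positions g +_) (∑-∖ uniq i∈ f) ⟩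
      ∑ positions g + (f i + ∑ (rem ∖ i) f)  ≡⟨ rotate (∑ positions g) _ (f i) ⟨
      ∑ positions g + ∑ (rem ∖ i) f + f i    ∎)
      where
      open ≡-Reasoning
      fi≡gi : f i ≡ g i
      fi≡gi = f≡g i λ i∈′ → proj₂ (∈-∖⁻ {xs = rem} i∈′) refl
      rotate : ∀ a b c → a + b + c ≡ a + (c + b)
      rotate = solve-∀

    -- Lets `suc j` stand for the cyclically next column even when `j` is the last one.
    column-wrap : ∀ xs → column block xs m ≡ column block xs 0
    column-wrap xs = ∑-cong xs λ {i} _ → fill-cong ([m+n]%n≡m%n 0 m) refl (letter i)

    -- If no remaining letter starts in column `L`, then column `suc L` is at least as high as
    -- column `L`; for `L` nonzero, balance makes it lower by one.
    stuck-at-zero : ∀ {rem} → Balanced block rem → (∀ {i} → i ∈ rem → block i ≢ ∑ rem letter % m) →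
                    ∑ rem letter % m ≡ 0
    stuck-at-zero {rem} bal stuck with ∑ rem letter % m ℕ.≟ 0
    ... | yes L≡0 = L≡0
    ... | no  L≢0 = contradiction (begin-strict
        S / m                       <⟨ n<1+n _ ⟩
        suc (S / m)                 ≡⟨ residueCount-low (n≢0⇒n>0 L≢0) ≤-refl ⟨
        residueCount L S            ≡⟨ bal L L<m ⟨
        column block rem L          ≤⟨ ∑-mono rem (λ {i} i∈ → fill-leave (λ eq →
                                         stuck i∈ (sym (%-injective L<m (block<m i) eq))) (letter i)) ⟩
        column block rem (suc L)    ≡⟨ next-column (m≤n⇒m<n∨m≡n L<m) ⟩
        S / m                       ∎) (<-irrefl refl)
      where
      open ≤-Reasoning
      S = ∑ rem letter
      L = S % m
      L<m = m%n<n S m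
      next-column : suc L < m ⊎ suc L ≡ m → column block rem (suc L) ≡ S / m
      next-column (inj₁ 1+L<m) = trans (bal (suc L) 1+L<m) (residueCount-high 1+L<m (inj₂ ≤-refl))
      next-column (inj₂ 1+L≡m) = trans (cong (column block rem) 1+L≡m) (trans (column-wrap rem)
        (trans (bal 0 (ℕ.>-nonZero⁻¹ m)) (residueCount-high (ℕ.>-nonZero⁻¹ m) (inj₁ refl))))

    -- Shifting the leftover letters one block to the right.

    open DecMembership (F._≟_ {n = N}) using (_∈?_)

    -- Block indices decrease from left to right, so the predecessor is the next block on the right.
    -- `F.pred` fixes block 0, whence the assumption below that no leftover letter lies there.
    shift : List (Fin N) → BlockFn m N
    shift rem i with i ∈? rem
    ... | yes _ = F.pred (b i)
    ... | no  _ = b i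

    suc-toℕ-pred : ∀ {n} (k : Fin n) → toℕ k ≢ 0 → suc (toℕ (F.pred k)) ≡ toℕ k
    suc-toℕ-pred F.zero    k≢0 = contradiction refl k≢0
    suc-toℕ-pred (F.suc k) k≢0 = cong suc (FP.toℕ-inject₁ k)

    shift-∈ : ∀ {rem i} → (∀ {i} → i ∈ rem → block i ≢ 0) → i ∈ rem → suc (toℕ (shift rem i)) ≡ block i
    shift-∈ {rem} {i} nz i∈ with i ∈? rem
    ... | yes _ = suc-toℕ-pred (b i) (nz i∈)
    ... | no i∉ = contradiction i∈ i∉

    shift-∉ : ∀ {rem i} → i ∉ rem → shift rem i ≡ b i
    shift-∉ {rem} {i} i∉ with i ∈? rem
    ... | yes i∈ = contradiction i∈ i∉
    ... | no  _  = refl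

    shift-≤ : ∀ {rem} → (∀ {i} → i ∈ rem → block i ≢ 0) → ∀ i → toℕ (shift rem i) ≤ block i
    shift-≤ {rem} nz i = case i ∈? rem of λ where
      (yes i∈) → ≤-trans (n≤1+n _) (≤-reflexive (shift-∈ nz i∈))
      (no  i∉) → ≤-reflexive (cong toℕ (shift-∉ i∉))

    -- The order could break only where a shifted letter precedes an unshifted one of the same
    -- block, and `Closed` excludes this.
    shift-partition : ∀ {rem} → (∀ {i} → i ∈ rem → block i ≢ 0) → Closed rem →
                      IsPartition b → IsPartition (shift rem)
    shift-partition {rem} nz closed part i j i≤j with i ∈? rem
    ... | no  i∉ = ≤-trans (shift-≤ nz j) (part i j i≤j)
    ... | yes i∈ with m≤n⇒m<n∨m≡n (part i j i≤j)
    ...   | inj₁ bj<bi = ℕ.s≤s⁻¹ (≤-trans (s≤s (shift-≤ nz j))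
                           (≤-trans bj<bi (≤-reflexive (sym (suc-toℕ-pred (b i) (nz i∈))))))
    ...   | inj₂ bj≡bi = ℕ.s≤s⁻¹ (≤-reflexive (trans (shift-∈ nz (closed i∈ i≤j (sym bj≡bi)))
                           (trans bj≡bi (sym (suc-toℕ-pred (b i) (nz i∈))))))

    -- When the total of rem is divisible by m, all columns of rem have the same number of filled
    -- cells, so rotating the columns of rem by one place changes no column.
    shift-balanced : ∀ {rem} → (∀ {i} → i ∈ rem → block i ≢ 0) → Localizes rem →
                     Balanced block rem → ∑ rem letter % m ≡ 0 →
                     Balanced block positions → Balanced (toℕ ∘ shift rem) positions
    shift-balanced {rem} nz loc bal-rem L≡0 bal j j<m = trans (+-cancelʳ-≡ (column block rem j) _ _ (begin
      column (toℕ ∘ shift rem) positions j + column block rem j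
        ≡⟨ loc _ _ (λ i i∉ → cong (λ k → fill j (toℕ k) (letter i)) (shift-∉ i∉)) ⟩
      column block positions j + column (toℕ ∘ shift rem) rem j
        ≡⟨ cong (column block positions j +_) rotated ⟩
      column block positions j + column block rem j ∎)) (bal j j<m)
      where
      open ≡-Reasoning
      S = ∑ rem letter
      constant : ∀ j → j < m → column block rem j ≡ S / m
      constant zero      j<m = trans (bal-rem 0 j<m) (residueCount-high j<m (inj₁ refl))
      constant j@(suc _) j<m = trans (bal-rem j j<m)
        (residueCount-high j<m (inj₂ (subst (_< j) (sym L≡0) (s≤s z≤n))))
      next-column : suc j < m ⊎ suc j ≡ m → column block rem (suc j) ≡ S / m
      next-column (inj₁ 1+j<m) = constant (suc j) 1+j<m
      next-column (inj₂ 1+j≡m) = trans (cong (column block rem) 1+j≡m)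
        (trans (column-wrap rem) (constant 0 (ℕ.>-nonZero⁻¹ m)))
      rotated : column (toℕ ∘ shift rem) rem j ≡ column block rem j
      rotated = begin
        column (toℕ ∘ shift rem) rem j  ≡⟨ ∑-cong rem (λ {i} i∈ → trans (sym (fill-suc-suc j _ (letter i)))
                                             (cong (λ k → fill (suc j) k (letter i)) (shift-∈ nz i∈))) ⟩
        column block rem (suc j)        ≡⟨ next-column (m≤n⇒m<n∨m≡n j<m) ⟩
        S / m                           ≡⟨ constant j j<m ⟨
        column block rem j              ∎

    -- The shift would be an equitable partition with `i` one block lower than in `b`.
    rightmost-not-stuck : ∀ {rem i} → IsRightmostEquitable m u b → Closed rem → Localizes rem →
                          Balanced block rem → i ∈ rem →
                          ¬ (∀ j → j ∈ rem → block j ≢ ∑ rem letter % m)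
    rightmost-not-stuck {rem} {i} (eq@(part , _) , least) closed loc bal i∈ stuck =
      1+n≰n (≤-trans (≤-reflexive (shift-∈ nz i∈)) (least (shift rem) shifted i))
      where
      L≡0 = stuck-at-zero bal (stuck _)
      nz : ∀ {j} → j ∈ rem → block j ≢ 0
      nz j∈ bj≡0 = stuck _ j∈ (trans bj≡0 (sym L≡0))
      shifted : IsEquitable m u (shift rem)
      shifted = shift-partition nz closed part
              , balanced⇒equitableColumn (shift rem)
                  (shift-balanced nz loc bal L≡0 (equitable⇒balanced b eq))

    -- Carries through the process the invariants that `rightmost-not-stuck` needs; each survives
    -- the removal of a head.
    rightmost-runs : ∀ k rem L → IsRightmostEquitable m u b → length rem ≡ k → Sorted rem → Closed rem →
                     Localizes rem → Balanced block rem → L ≡ ∑ rem letter % m →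
                     runProcess m u b k rem L ≡ true
    rightmost-runs zero    rem L rm len sorted closed loc bal L≡ = refl
    rightmost-runs (suc k) rem@(r ∷ _) L rm len sorted closed loc bal refl
      with filter (λ i → block i ℕ.≟ L) rem in eq
    ... | []    = contradiction stuck (rightmost-not-stuck rm closed loc bal (here refl))
      where
      stuck : ∀ j → j ∈ rem → block j ≢ L
      stuck j j∈ bj≡L with subst (_ ∈_) eq (∈-filter⁺ (λ i → block i ℕ.≟ L) j∈ bj≡L)
      ... | ()
    ... | i ∷ _ = rightmost-runs k (rem ∖ i) _ rm (length-∖ sorted i∈ len) (sorted-∖ sorted i)
                    (closed-∖ head closed) (localizes-∖ uniq i∈ loc)
                    (balanced-∖ uniq i∈ (proj₁ (proj₂ head)) bal) (next-% uniq i∈)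
      where
      head = filter-head sorted eq
      i∈ = proj₁ head
      uniq = sorted⇒unique sorted

    rightmost⇒successful : IsRightmostEquitable m u b → IsSuccessful m u b
    rightmost⇒successful rm@(eq@(part , _) , _) = part , rightmost-runs N positions _ rm
      (length-tabulate id) positions-sorted (λ {_} {j} _ _ _ → ∈-allFin j)
      (λ f g _ → +-comm (∑ positions f) (∑ positions g)) (equitable⇒balanced b eq) refl

theorem4p12 : (m N : ℕ) .{{_ : NonZero m}} .{{_ : NonZero N}} (u : Word m N) (b : BlockFn m N) →
    (IsRightmostEquitable m u b → IsSuccessful m u b) × (IsSuccessful m u b → IsRightmostEquitable m u b)
theorem4p12 m N u b = rightmost⇒successful b , successful⇒rightmost b
  where open Process m N u
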